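{- There is a universal constant $c>0$ such that for every integer $t\ge 2$ and every $n\ge 2$, every $t$-pg graph on $n$ vertices has arboricity at most $c\cdot t^3\cdot\log^3 n\cdot n^{c/t}$.
   Context: Let $V$ be a finite vertex set and $t\ge 2$ an integer. A sequence of edge sets $(E_1,\dots,E_k)$ on $V$ is $t$-pg if for each $i\in[k]$: $E_i$ is a matching on $V$, and $d_{G_{i-1}}(u,v)>t$ for every $\{u,v\}\in E_i$, where $G_{i-1}$ is the graph on $V$ with edge set $\bigcup_{j\le i-1}E_j$ and $d$ denotes hop distance (infinite between disconnected vertices). A graph $G=(V,E)$ is $t$-pg if $E$ is the union of some $t$-pg sequence on $V$. The arboricity of a graph is the minimum number of edge-disjoint forests whose union is the graph. -}

module Defs where

open import Data.Nat using (ℕ; zero; suc; _+_; _*_; _^_; _≤_; _<_)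
open import Data.Nat.Logarithm using (⌊log₂_⌋)
open import Data.Fin using (Fin; toℕ; inject₁; fromℕ) renaming (zero to fzero; suc to fsuc)
open import Data.Bool using (Bool; true; false)
open import Data.Product using (Σ; ∃; ∃-syntax; _×_; _,_)
open import Relation.Nullary using (¬_)
open import Relation.Binary.PropositionalEquality using (_≡_)
open import Function.Definitions using (Injective)
open import Function.Bundles using (_⇔_)

EdgeSet : ℕ → Set
EdgeSet n = Fin n → Fin n → Bool

IsEdgeSet : ∀ {n} → EdgeSet n → Set
IsEdgeSet {n} E = (∀ (u v : Fin n) → E u v ≡ E v u) × (∀ (u : Fin n) → E u u ≡ false)

Graph : ℕ → Set
Graph n = Σ (EdgeSet n) IsEdgeSet

Rel : ℕ → Set₁
Rel n = Fin n → Fin n → Set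

data Walk {n : ℕ} (R : Rel n) : Fin n → Fin n → ℕ → Set where
  here : ∀ u → Walk R u u 0
  step : ∀ {u v w ℓ} → R u v → Walk R v w ℓ → Walk R u w (suc ℓ)

-- Hop distance d_R(u,v) > t (infinite if disconnected).
DistGt : ∀ {n} → Rel n → ℕ → Fin n → Fin n → Set
DistGt R t u v = ∀ ℓ → ℓ ≤ t → ¬ Walk R u v ℓ

IsMatching : ∀ {n} → EdgeSet n → Set
IsMatching {n} E = ∀ (u v w : Fin n) → E u v ≡ true → E u w ≡ true → v ≡ w

PrefixUnion : ∀ {n k} → (Fin k → EdgeSet n) → ℕ → Rel n
PrefixUnion {n} {k} Es i u v = ∃[ j ] (toℕ j < i × Es j u v ≡ true)

IsPgSeq : ∀ {n k} → ℕ → (Fin k → EdgeSet n) → Set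
IsPgSeq {n} {k} t Es =
  (∀ (i : Fin k) → IsEdgeSet (Es i)) ×
  (∀ (i : Fin k) → IsMatching (Es i)) ×
  (∀ (i : Fin k) (u v : Fin n) → Es i u v ≡ true → DistGt (PrefixUnion Es (toℕ i)) t u v)

IsPg : ∀ {n} → ℕ → Graph n → Set
IsPg {n} t (E , _) =
  ∃[ k ] Σ (Fin k → EdgeSet n) λ Es →
    IsPgSeq t Es × (∀ (u v : Fin n) → (E u v ≡ true) ⇔ (∃[ i ] Es i u v ≡ true))

HasCycle : ∀ {n} → Rel n → Set
HasCycle {n} R =
  ∃[ p ] Σ (Fin (suc (suc (suc p))) → Fin n) λ c →
    Injective _≡_ _≡_ c ×
    (∀ (i : Fin (suc (suc p))) → R (c (inject₁ i)) (c (fsuc i))) ×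
    R (c (fromℕ (suc (suc p)))) (c fzero)

IsForest : ∀ {n} → Rel n → Set
IsForest R = ¬ HasCycle R

-- The edges of G decompose into k edge-disjoint forests: an edge colouring
-- with k colours each of whose colour classes is acyclic.
-- (arboricity G ≤ k  iff  ForestDecomposition G k)
ForestDecomposition : ∀ {n} → Graph n → ℕ → Set
ForestDecomposition {n} (E , _) k =
  Σ (Fin n → Fin n → Fin k) λ col →
    (∀ (u v : Fin n) → col u v ≡ col v u) ×
    (∀ (c : Fin k) → IsForest (λ u v → E u v ≡ true × col u v ≡ c))

{-# OPTIONS --safe #-}
module Submission where

-- Let k = ⌊(t+1)/2⌋ and s = r + 1, where r is the integer part of the k-th root of n.
-- Peel the graph k times, each time deleting every edge that is among the s
-- earliest remaining edges at one of its endpoints.  An edge {u,v} surviving all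
-- k rounds yields s ^ k walks of length k out of v with decreasing times: step back
-- to any of s earlier edges that survived one round less, and repeat.  Their
-- endpoints are distinct, since two of them meeting would close, around the latest
-- edge where they diverge, a cycle of length at most 2k ≤ t + 1.  As n < s ^ k, no
-- edge survives.
-- Colour an edge by the round in which it is deleted and by its smaller rank at
-- its two endpoints.  The latest edge of a monochromatic cycle attains its rank at
-- an endpoint where the other cycle edge is earlier, hence of smaller rank, which
-- is absurd.  So k s ≤ 2 t n ^ (1/k) forests suffice.

open import Defs
open import Data.Nat using (ℕ; zero; suc; _+_; _*_; _^_; _⊓_; _≤_; _<_; ⌊_/2⌋; s≤s⁻¹; z<s; >-nonZero; _≤?_)
open import Data.Nat.Logarithm using (⌊log₂_⌋; ⌊log₂⌋-mono-≤)
open import Data.Nat.Properties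
open import Data.Product using (Σ; ∃; ∃-syntax; _×_; _,_; proj₁; proj₂)
open import Data.Sum using (_⊎_; inj₁; inj₂)
open import Data.Bool using (true)
import Data.Bool.Properties as Bool
open import Data.Fin using (Fin; toℕ; fromℕ; fromℕ<; inject₁; combine; quotient; remainder)
  renaming (zero to fzero; suc to fsuc; _≤?_ to _≤ᶠ?_)
import Data.Fin.Properties as Fin
open import Data.Fin.Relation.Unary.Top using (view; ‵fromℕ; ‵inject₁)
open import Data.List using (allFin)
open import Data.List.Extrema ≤-totalOrder using (argmax; f[xs]≤f[argmax])
open import Data.List.Membership.Propositional.Properties using (∈-allFin)
import Data.List.Relation.Unary.All as All
open import Algebra.Properties.CommutativeSemigroup *-commutativeSemigroup using (interchange)
open import Function.Base using (_∘_)
open import Function.Bundles using (Equivalence)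
open import Function.Definitions using (Injective)
open import Relation.Binary.Definitions using (tri<; tri≈; tri>)
open import Relation.Binary.PropositionalEquality
  using (_≡_; _≢_; refl; sym; trans; cong; cong₂; subst; subst₂)
open import Relation.Nullary using (¬_; Dec; yes; no; contradiction; _×-dec_)
open import Relation.Unary using (Decidable)

-- Counting below a bound, and walks

count : ∀ {P : ℕ → Set} → Decidable P → ℕ → ℕ
count P? zero = 0
count P? (suc m) with P? m
... | yes _ = suc (count P? m)
... | no  _ = count P? m

module _ {P : ℕ → Set} (P? : Decidable P) where

  count-≤-suc : ∀ m → count P? m ≤ count P? (suc m)
  count-≤-suc m with P? m
  ... | yes _ = n≤1+n _
  ... | no  _ = ≤-refl

  count-mono-< : ∀ {m} o → P m → m < o → count P? m < count P? o
  count-mono-< {m} (suc o) p m<1+o with m<1+n⇒m<n∨m≡n m<1+o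
  ... | inj₁ m<o = <-≤-trans (count-mono-< o p m<o) (count-≤-suc o)
  ... | inj₂ refl with P? m
  ...   | yes _ = ≤-refl
  ...   | no ¬p = contradiction p ¬p

  -- The count starts at 0 and grows by at most one per step, exactly where `P` holds. This locates
  -- the edge of a prescribed rank at a vertex.
  count-surjective : ∀ o {r} → r < count P? o → ∃[ m ] (m < o × P m × count P? m ≡ r)
  count-surjective (suc o) r< with P? o
  ... | no _ = let m , m<o , p , eq = count-surjective o r< in m , m<n⇒m<1+n m<o , p , eq
  ... | yes p with m<1+n⇒m<n∨m≡n r<
  ...   | inj₁ r<c = let m , m<o , q , eq = count-surjective o r<c in m , m<n⇒m<1+n m<o , q , eq
  ...   | inj₂ r≡c = o , ≤-refl , p , sym r≡c

module _ {n : ℕ} {R : Rel n} where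

  walk-++ : ∀ {u v w a b} → Walk R u v a → Walk R v w b → Walk R u w (a + b)
  walk-++ (here _)   q = q
  walk-++ (step e p) q = step e (walk-++ p q)

  walk-reverse : (∀ {u v} → R u v → R v u) → ∀ {u v a} → Walk R u v a → Walk R v u a
  walk-reverse R-sym (here u) = here u
  walk-reverse R-sym (step {ℓ = ℓ} e p) =
    subst (Walk R _ _) (+-comm ℓ 1) (walk-++ (walk-reverse R-sym p) (step (R-sym e) (here _)))

walk-map : ∀ {n} {R S : Rel n} → (∀ {u v} → R u v → S u v) →
  ∀ {u v a} → Walk R u v a → Walk S u v a
walk-map f (here u)   = here u
walk-map f (step e p) = step (f e) (walk-map f p)

-- Cycles and forests

prev : ∀ {m} → Fin (suc m) → Fin (suc m)
prev fzero    = fromℕ _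
prev (fsuc i) = inject₁ i

prev-surjective : ∀ {m} (x : Fin (suc m)) → ∃[ y ] prev y ≡ x
prev-surjective x with view x
... | ‵fromℕ     = fzero , refl
... | ‵inject₁ i = fsuc i , refl

-- Here the length of at least three enters: the two cycle neighbours of a vertex differ.
prev-prev≢ : ∀ {p} (x : Fin (suc (suc (suc p)))) → prev (prev x) ≢ x
prev-prev≢ fzero ()
prev-prev≢ (fsuc fzero) ()
prev-prev≢ (fsuc (fsuc i)) eq = <⇒≢ (m<n+m (toℕ i) {2} z<s)
  (trans (sym (trans (Fin.toℕ-inject₁ (inject₁ i)) (Fin.toℕ-inject₁ i))) (cong toℕ eq))

OnlyEdgeUpTo : ∀ {n} → (ℕ → Rel n) → ℕ → Fin n → Fin n → Set
OnlyEdgeUpTo Timed i u v = ∀ {j w} → Timed j u w → j ≤ i → w ≡ v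

module _ {n : ℕ} (Timed : ℕ → Rel n) (Timed-sym : ∀ {i u v} → Timed i u v → Timed i v u) where

  -- At either endpoint of the latest edge of a cycle, the other cycle edge is no later.
  -- `OnlyEdgeUpTo` there would identify the two cycle neighbours of that endpoint.
  isForest : (∀ {i u v} → Timed i u v → OnlyEdgeUpTo Timed i u v ⊎ OnlyEdgeUpTo Timed i v u) →
    (R : Rel n) → (∀ {u v} → R u v → ∃[ i ] Timed i u v) → IsForest R
  isForest onlyEdge R timed (p , c , c-inj , path , closing) = at-latest (onlyEdge (edge x))
    where
    cycleEdge : ∀ x → R (c (prev x)) (c x)
    cycleEdge fzero    = closing
    cycleEdge (fsuc i) = path i

    time : Fin (suc (suc (suc p))) → ℕ
    time x = proj₁ (timed (cycleEdge x))

    edge : ∀ x → Timed (time x) (c (prev x)) (c x)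
    edge x = proj₂ (timed (cycleEdge x))

    x : Fin (suc (suc (suc p)))
    x = argmax time fzero (allFin _)

    latest : ∀ y → time y ≤ time x
    latest y = All.lookup (f[xs]≤f[argmax] {f = time} fzero (allFin _)) (∈-allFin y)

    at-latest : ¬ (OnlyEdgeUpTo Timed (time x) (c (prev x)) (c x) ⊎
      OnlyEdgeUpTo Timed (time x) (c x) (c (prev x)))
    at-latest (inj₁ only) =
      prev-prev≢ x (c-inj (only (Timed-sym (edge (prev x))) (latest (prev x))))
    at-latest (inj₂ only) =
      -- `y` is the successor of `x` on the cycle, so its edge is the other one at `c x`; `only`
      -- forces `y` to be `prev x`.
      let y , eq = prev-surjective x
          edge-y = subst (λ z → Timed (time y) (c z) (c y)) eq (edge y)
      in prev-prev≢ x (trans (cong prev (sym (c-inj (only edge-y (latest y))))) eq)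

-- Symmetry is obtained by always choosing for the pair with its smaller vertex first; `a₀` is the
-- value on non-edges.
symmetricChoice : ∀ {n} {A : Set} (E : EdgeSet n) → (∀ u v → E u v ≡ E v u) → A →
  (Good : Fin n → Fin n → A → Set) → (∀ {u v a} → Good u v a → Good v u a) →
  (∀ u v → E u v ≡ true → ∃[ a ] Good u v a) →
  Σ (Fin n → Fin n → A) λ f →
    (∀ u v → f u v ≡ f v u) × (∀ u v → E u v ≡ true → Good u v (f u v))
symmetricChoice {n} {A} E E-sym a₀ Good Good-sym good = f , f-sym , f-good
  where
  choose : ∀ u v → ∃[ a ] (E u v ≡ true → Good u v a)
  choose u v with E u v Bool.≟ true
  ... | yes e = let a , g = good u v e in a , λ _ → g
  ... | no ¬e = a₀ , λ e → contradiction e ¬e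

  f : Fin n → Fin n → A
  f u v with u ≤ᶠ? v
  ... | yes _ = proj₁ (choose u v)
  ... | no  _ = proj₁ (choose v u)

  f-sym : ∀ u v → f u v ≡ f v u
  f-sym u v with u ≤ᶠ? v | v ≤ᶠ? u
  ... | yes u≤v | yes v≤u = cong₂ (λ x y → proj₁ (choose x y)) u≡v (sym u≡v)
    where u≡v = Fin.toℕ-injective (≤-antisym u≤v v≤u)
  ... | yes _   | no  _   = refl
  ... | no  _   | yes _   = refl
  ... | no  u≰v | no  v≰u = contradiction (<⇒≤ (≰⇒> u≰v)) v≰u

  f-good : ∀ u v → E u v ≡ true → Good u v (f u v)
  f-good u v e with u ≤ᶠ? v
  ... | yes _ = proj₂ (choose u v) e
  ... | no  _ = Good-sym (proj₂ (choose v u) (trans (E-sym v u) e))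

-- Peeling

Before : ∀ {n} → (ℕ → Rel n) → ℕ → Rel n
Before Edge i u v = ∃[ j ] (j < i × Edge j u v)

module Peeling {n : ℕ} (t s : ℕ) (Edge : ℕ → Rel n)
  (edge? : ∀ i u v → Dec (Edge i u v))
  (edge-sym : ∀ {i u v} → Edge i u v → Edge i v u)
  (matching : ∀ {i u v w} → Edge i u v → Edge i u w → v ≡ w)
  (far : ∀ {i u v} → Edge i u v → DistGt (Before Edge i) t u v)
  where

  -- Edges of one time form a matching, so the times counted by `rank j i u` correspond to the edges
  -- at `u` before time `i` that survive `j` rounds. `minRank` below `s` thus means being among the
  -- `s` earliest at some endpoint. Deciding survival is part of the recursion because `count` needs
  -- it.
  mutual
    Surviving : ℕ → ℕ → Rel n
    Surviving zero    i u v = Edge i u v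
    Surviving (suc j) i u v = Surviving j i u v × s ≤ minRank j i u v

    minRank : ℕ → ℕ → Fin n → Fin n → ℕ
    minRank j i u v = rank j i u ⊓ rank j i v

    rank : ℕ → ℕ → Fin n → ℕ
    rank j i u = count (busy? j u) i

    busy? : ∀ j u → Decidable (λ i → ∃[ v ] Surviving j i u v)
    busy? j u i = Fin.any? (surviving? j i u)

    surviving? : ∀ j i u v → Dec (Surviving j i u v)
    surviving? zero    i u v = edge? i u v
    surviving? (suc j) i u v = surviving? j i u v ×-dec s ≤? minRank j i u v

  surviving⇒edge : ∀ j {i u v} → Surviving j i u v → Edge i u v
  surviving⇒edge zero    e       = e
  surviving⇒edge (suc j) (e , _) = surviving⇒edge j e

  surviving-sym : ∀ j {i u v} → Surviving j i u v → Surviving j i v u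
  surviving-sym zero e = edge-sym e
  surviving-sym (suc j) {i} {u} {v} (e , s≤) =
    surviving-sym j e , subst (s ≤_) (⊓-comm (rank j i u) (rank j i v)) s≤

  Class : ℕ → ℕ → ℕ → Rel n
  Class j r i u v = Surviving j i u v × minRank j i u v ≡ r

  class-sym : ∀ j {r i u v} → Class j r i u v → Class j r i v u
  class-sym j {i = i} {u} {v} (e , eq) =
    surviving-sym j e , trans (⊓-comm (rank j i v) (rank j i u)) eq

  -- A strictly earlier edge of the class at `u` is itself counted in `rank j i u`, so its own rank
  -- at `u` is below `r`, although its `minRank` is `r`. At equal times the matching property
  -- decides.
  at-minimum : ∀ j {r i u v} → Surviving j i u v → rank j i u ≡ r → OnlyEdgeUpTo (Class j r) i u v
  at-minimum j {i = i} {u} e refl {i′} {w} (e′ , eq) i′≤i with m≤n⇒m<n∨m≡n i′≤i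
  ... | inj₁ i′<i = contradiction (count-mono-< (busy? j u) i (w , e′) i′<i)
    (≤⇒≯ (≤-trans (≤-reflexive (sym eq)) (m⊓n≤m (rank j i′ u) (rank j i′ w))))
  ... | inj₂ refl = matching (surviving⇒edge j e′) (surviving⇒edge j e)

  class-onlyEdge : ∀ j {r i u v} → Class j r i u v →
    OnlyEdgeUpTo (Class j r) i u v ⊎ OnlyEdgeUpTo (Class j r) i v u
  class-onlyEdge j {r} {i} {u} {v} (e , refl) with ⊓-sel (rank j i u) (rank j i v)
  ... | inj₁ eq = inj₁ (at-minimum j e (sym eq))
  ... | inj₂ eq = inj₂ (at-minimum j (surviving-sym j e) (sym eq))

  survives⊎deleted : ∀ k {i u v} → Edge i u v →
    Surviving k i u v ⊎ ∃[ j ] (j < k × Surviving j i u v × minRank j i u v < s)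
  survives⊎deleted zero e = inj₁ e
  survives⊎deleted (suc k) {i} {u} {v} e with survives⊎deleted k e
  ... | inj₂ (j , j<k , deleted) = inj₂ (j , m<n⇒m<1+n j<k , deleted)
  ... | inj₁ e′ with s ≤? minRank k i u v
  ...   | yes s≤ = inj₁ (e′ , s≤)
  ...   | no  s≰ = inj₂ (k , ≤-refl , e′ , ≰⇒> s≰)

  -- Walks with decreasing times out of a surviving edge

  before-mono : ∀ {i j} → i ≤ j → ∀ {u v} → Before Edge i u v → Before Edge j u v
  before-mono i≤j (h , h<i , e) = h , <-≤-trans h<i i≤j , e

  -- Crossing the earlier edge `e`, following `p` and returning along `q` joins the ends of the
  -- later edge `e′` by `suc ℓ + ℓ` edges, all before time `j`, against `far`.
  diverge : ∀ {i j v w w′ x ℓ} → suc ℓ + ℓ ≤ t → i < j → Edge i v w → Edge j v w′ →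
    Walk (Before Edge i) w x ℓ → ¬ Walk (Before Edge j) w′ x ℓ
  diverge bound i<j e e′ p q = far e′ _ bound
    (walk-++ (step (_ , i<j , e) (walk-map (before-mono (<⇒≤ i<j)) p))
             (walk-reverse (λ (h , h<j , e) → h , h<j , edge-sym e) q))

  -- Induction on the rounds: the walk continues from `v` along one of `s` edges earlier than `i`,
  -- each surviving one round less. Recording that all edges precede `i` keeps the times decreasing.
  reachable : ∀ j → j + j ≤ suc t → ∀ {i u v} → Surviving j i u v →
    Σ (Fin (s ^ j) → Fin n) λ f → Injective _≡_ _≡_ f × (∀ x → Walk (Before Edge i) v (f x) j)
  reachable zero _ {v = v} e = (λ _ → v) , (λ { {fzero} {fzero} _ → refl }) , λ _ → here v
  reachable (suc j) bound {i} {u} {v} (_ , s≤) = f , f-injective , walk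
    where
    -- Two walks of length `suc j` close up to `2 * suc j` edges; leaving out the latest gives the
    -- detour length in `diverge`.
    bound′ : suc j + j ≤ t
    bound′ = subst (_≤ t) (+-suc j j) (s≤s⁻¹ bound)

    -- Surviving the last round means rank at least `s` at `v`, so each rank below `s` is attained
    -- there before time `i`.
    earlier : (a : Fin s) →
      ∃[ h ] (h < i × (∃[ w ] Surviving j h v w) × rank j h v ≡ toℕ a)
    earlier a = count-surjective (busy? j v) i
      (<-≤-trans (Fin.toℕ<n a) (≤-trans s≤ (m⊓n≤n (rank j i u) (rank j i v))))

    h : Fin s → ℕ
    h a = proj₁ (earlier a)

    h<i : ∀ a → h a < i
    h<i a = proj₁ (proj₂ (earlier a))

    w : Fin s → Fin n
    w a = proj₁ (proj₁ (proj₂ (proj₂ (earlier a))))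

    edge : ∀ a → Surviving j (h a) v (w a)
    edge a = proj₂ (proj₁ (proj₂ (proj₂ (earlier a))))

    h-injective : ∀ {a b} → h a ≡ h b → a ≡ b
    h-injective {a} {b} eq = Fin.toℕ-injective (trans (sym (proj₂ (proj₂ (proj₂ (earlier a)))))
      (trans (cong (λ m → rank j m v) eq) (proj₂ (proj₂ (proj₂ (earlier b))))))

    further : ∀ a → Σ (Fin (s ^ j) → Fin n) λ g →
      Injective _≡_ _≡_ g × (∀ x → Walk (Before Edge (h a)) (w a) (g x) j)
    further a = reachable j (≤-trans (m≤n+m (j + j) 1) (≤-trans bound′ (n≤1+n t))) (edge a)

    g : Fin s → Fin (s ^ j) → Fin n
    g a = proj₁ (further a)

    g-walk : ∀ a x → Walk (Before Edge (h a)) (w a) (g a x) j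
    g-walk a = proj₂ (proj₂ (further a))

    g-injective : ∀ {a b x y} → g a x ≡ g b y → a ≡ b × x ≡ y
    -- First edges of different times fall under `diverge`; equal times give the same first edge,
    -- and the induction hypothesis applies.
    g-injective {a} {b} {x} {y} eq with <-cmp (h a) (h b)
    ... | tri< ha<hb _ _ = contradiction (g-walk b y)
      (diverge bound′ ha<hb (surviving⇒edge j (edge a)) (surviving⇒edge j (edge b))
        (subst (λ z → Walk (Before Edge (h a)) (w a) z j) eq (g-walk a x)))
    ... | tri> _ _ hb<ha = contradiction (g-walk a x)
      (diverge bound′ hb<ha (surviving⇒edge j (edge b)) (surviving⇒edge j (edge a))
        (subst (λ z → Walk (Before Edge (h b)) (w b) z j) (sym eq) (g-walk b y)))
    ... | tri≈ _ ha≡hb _ with refl ← h-injective {a} {b} ha≡hb = refl , proj₁ (proj₂ (further a)) eq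

    f : Fin (s * s ^ j) → Fin n
    f x = g (quotient (s ^ j) x) (remainder {s} (s ^ j) x)

    f-injective : Injective _≡_ _≡_ f
    f-injective {x} {y} eq = let q , r = g-injective eq in
      trans (sym (Fin.combine-remQuot {s} (s ^ j) x))
        (trans (cong₂ combine q r) (Fin.combine-remQuot {s} (s ^ j) y))

    walk : ∀ x → Walk (Before Edge i) v (f x) (suc j)
    walk x = step (_ , h<i a , surviving⇒edge j (edge a)) (walk-map (before-mono (<⇒≤ (h<i a))) (g-walk a _))
      where a = quotient {s} (s ^ j) x

  ¬surviving : ∀ k → k + k ≤ suc t → n < s ^ k → ∀ {i u v} → ¬ Surviving k i u v
  ¬surviving k bound n<s^k e =
    <⇒≱ n<s^k (Fin.injective⇒≤ (proj₁ (proj₂ (reachable k bound e))))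

  forestDecomposition : ∀ k → k + k ≤ suc t → n < s ^ k → 0 < k * s → (G : Graph n) →
    (∀ {u v} → proj₁ G u v ≡ true → ∃[ i ] Edge i u v) → ForestDecomposition G (k * s)
  forestDecomposition k bound n<s^k 0<ks (E , E-sym , _) timed =
    col , col-sym , λ c → isForest (ClassOf c) (class-sym (round c)) (class-onlyEdge (round c))
      (λ u v → E u v ≡ true × col u v ≡ c)
      λ { {u} {v} (e , refl) → col-good u v e }
    where
    -- A colour encodes a pair: the round of deletion and the smaller rank in that round.
    round : Fin (k * s) → ℕ
    round c = toℕ (quotient {k} s c)

    ClassOf : Fin (k * s) → ℕ → Rel n
    ClassOf c = Class (round c) (toℕ (remainder {k} s c))

    good : ∀ u v → E u v ≡ true → ∃[ c ] ∃[ i ] ClassOf c i u v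
    good u v e with i , e′ ← timed e with survives⊎deleted k e′
    ... | inj₁ e″ = contradiction e″ (¬surviving k bound n<s^k)
    ... | inj₂ (j , j<k , e″ , r<s) = c , i , subst₂ (λ a b → Class a b i u v)
      (trans (sym (Fin.toℕ-fromℕ< j<k)) (cong (toℕ ∘ proj₁) (sym c≡)))
      (trans (sym (Fin.toℕ-fromℕ< r<s)) (cong (toℕ ∘ proj₂) (sym c≡)))
      (e″ , refl)
      where
      c  = combine (fromℕ< j<k) (fromℕ< r<s)
      c≡ = Fin.remQuot-combine (fromℕ< j<k) (fromℕ< r<s)

    -- `0<ks` supplies the colour of the non-edges.
    choice = symmetricChoice E E-sym (fromℕ< 0<ks) (λ u v c → ∃[ i ] ClassOf c i u v)
      (λ {_} {_} {c} (i , e) → i , class-sym (round c) e) good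

    col      = proj₁ choice
    col-sym  = proj₁ (proj₂ choice)
    col-good = proj₂ (proj₂ choice)

-- Arithmetic of the bound

^-distribʳ-* : ∀ m n o → (m * n) ^ o ≡ m ^ o * n ^ o
^-distribʳ-* m n zero    = refl
^-distribʳ-* m n (suc o) =
  trans (cong (m * n *_) (^-distribʳ-* m n o)) (interchange m n (m ^ o) (n ^ o))

integerRoot : ∀ n k → 0 < k → 0 < n → ∃[ r ] (0 < r × r ^ k ≤ n × n < suc r ^ k)
integerRoot n k@(suc k′) _ 0<n = search n (m≤m*n (suc n) (suc n ^ k′) ⦃ m^n≢0 (suc n) k′ ⦄)
  where
  -- Downward search from `n`; it stops by `m = 1` at the latest, since `1 ^ k ≤ n`.
  search : ∀ m → n < suc m ^ k → ∃[ r ] (0 < r × r ^ k ≤ n × n < suc r ^ k)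
  search zero    n< = contradiction (subst (n <_) (^-zeroˡ k) n<) (≤⇒≯ 0<n)
  search (suc m) n< with suc m ^ k ≤? n
  ... | yes ≤n = suc m , z<s , ≤n , n<
  ... | no  ≰n = search m (≰⇒> ≰n)

-- Raising to the power `t` avoids the real exponent `2/t`: as `t ≤ k + k`, `r ^ t` is at most the
-- square of `r ^ k`, hence at most `n ^ 2`.
size-bound : ∀ {t n k r} L → 0 < L → 0 < t → k ≤ t → t ≤ k + k → 0 < r → r ^ k ≤ n →
  (k * suc r) ^ t ≤ (2 * t ^ 3 * L ^ 3) ^ t * n ^ 2
size-bound {t} {n} {k} {r} L 0<L 0<t k≤t t≤2k 0<r r^k≤n = begin
  (k * suc r) ^ t              ≤⟨ ^-monoˡ-≤ t (*-mono-≤ k≤t 1+r≤2r) ⟩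
  (t * (2 * r)) ^ t            ≡⟨ cong (_^ t) (trans (sym (*-assoc t 2 r)) (cong (_* r) (*-comm t 2))) ⟩
  (2 * t * r) ^ t              ≡⟨ ^-distribʳ-* (2 * t) r t ⟩
  (2 * t) ^ t * r ^ t          ≤⟨ *-mono-≤ (^-monoˡ-≤ t 2t≤) (^-monoʳ-≤ r ⦃ >-nonZero 0<r ⦄ t≤2k) ⟩
  (2 * t ^ 3 * L ^ 3) ^ t * r ^ (k + k)     ≡⟨ cong ((2 * t ^ 3 * L ^ 3) ^ t *_) (^-distribˡ-+-* r k k) ⟩
  (2 * t ^ 3 * L ^ 3) ^ t * (r ^ k * r ^ k) ≤⟨ *-monoʳ-≤ ((2 * t ^ 3 * L ^ 3) ^ t) (*-mono-≤ r^k≤n r^k≤n) ⟩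
  (2 * t ^ 3 * L ^ 3) ^ t * (n * n)         ≡⟨ cong (λ m → (2 * t ^ 3 * L ^ 3) ^ t * (n * m)) (sym (*-identityʳ n)) ⟩
  (2 * t ^ 3 * L ^ 3) ^ t * n ^ 2           ∎
  where
  open ≤-Reasoning

  1+r≤2r : suc r ≤ 2 * r
  1+r≤2r = +-mono-≤ 0<r (≤-reflexive (sym (+-identityʳ r)))

  2t≤ : 2 * t ≤ 2 * t ^ 3 * L ^ 3
  2t≤ = ≤-trans (*-monoʳ-≤ 2 (m≤m*n t (t ^ 2) ⦃ m^n≢0 t 2 ⦃ >-nonZero 0<t ⦄ ⦄))
    (m≤m*n (2 * t ^ 3) (L ^ 3) ⦃ m^n≢0 L 3 ⦃ >-nonZero 0<L ⦄ ⦄)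

n≤⌊1+n/2⌋+⌊1+n/2⌋ : ∀ n → n ≤ ⌊ suc n /2⌋ + ⌊ suc n /2⌋
n≤⌊1+n/2⌋+⌊1+n/2⌋ n =
  subst (_≤ ⌊ suc n /2⌋ + ⌊ suc n /2⌋) (⌊n/2⌋+⌈n/2⌉≡n n) (+-monoˡ-≤ ⌊ suc n /2⌋ (⌊n/2⌋≤⌈n/2⌉ n))

⌊n/2⌋+⌊n/2⌋≤n : ∀ n → ⌊ n /2⌋ + ⌊ n /2⌋ ≤ n
⌊n/2⌋+⌊n/2⌋≤n n =
  subst (⌊ n /2⌋ + ⌊ n /2⌋ ≤_) (⌊n/2⌋+⌈n/2⌉≡n n) (+-monoʳ-≤ ⌊ n /2⌋ (⌊n/2⌋≤⌈n/2⌉ n))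

theorem4p2 : ∃[ c ] (0 < c × (∀ (t n : ℕ) → 2 ≤ t → 2 ≤ n → (G : Graph n) → IsPg t G →
    ∃[ a ] (ForestDecomposition G a × a ^ t ≤ (c * (t ^ 3) * (⌊log₂ n ⌋ ^ 3)) ^ t * n ^ c)))
-- The constant 2 covers both `suc r ≤ 2 * r` and the exponent from `t ≤ k + k`.
theorem4p2 = 2 , z<s , arboricity
  where
  arboricity : ∀ t n → 2 ≤ t → 2 ≤ n → (G : Graph n) → IsPg t G →
    ∃[ a ] (ForestDecomposition G a × a ^ t ≤ (2 * (t ^ 3) * (⌊log₂ n ⌋ ^ 3)) ^ t * n ^ 2)
  arboricity t n 2≤t 2≤n G (_ , Es , (isEdgeSet , isMatching , far) , union) =
    let r , 0<r , r^k≤n , n<[1+r]^k = integerRoot n k 0<k (<⇒≤ 2≤n) in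
    k * suc r ,
    Peeling.forestDecomposition t (suc r) Edge edge? edge-sym matching edge-far k
      (⌊n/2⌋+⌊n/2⌋≤n (suc t)) n<[1+r]^k (*-mono-≤ 0<k z<s) G timed ,
    size-bound ⌊log₂ n ⌋ (⌊log₂⌋-mono-≤ 2≤n) (<⇒≤ 2≤t) (⌈n/2⌉≤n t)
      (n≤⌊1+n/2⌋+⌊1+n/2⌋ t) 0<r r^k≤n
    where
    k : ℕ
    -- The largest `k` with `k + k ≤ suc t`, as peeling requires; it still satisfies `t ≤ k + k`, as
    -- `size-bound` requires.
    k = ⌊ suc t /2⌋

    0<k : 0 < k
    0<k = ⌊n/2⌋-mono {2} (m≤n⇒m≤1+n 2≤t)

    Edge : ℕ → Rel n
    Edge i u v = ∃[ j ] (toℕ j ≡ i × Es j u v ≡ true)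

    edge? : ∀ i u v → Dec (Edge i u v)
    edge? i u v = Fin.any? (λ j → (toℕ j ≟ i) ×-dec (Es j u v Bool.≟ true))

    edge-sym : ∀ {i u v} → Edge i u v → Edge i v u
    edge-sym {u = u} {v} (j , eq , e) = j , eq , trans (proj₁ (isEdgeSet j) v u) e

    matching : ∀ {i u v w} → Edge i u v → Edge i u w → v ≡ w
    matching (j , refl , e) (j′ , eq , e′) with refl ← Fin.toℕ-injective eq =
      isMatching j _ _ _ e e′

    edge-far : ∀ {i u v} → Edge i u v →
      DistGt (Before Edge i) t u v
    edge-far (j , refl , e) ℓ ℓ≤t p =
      far j _ _ e ℓ ℓ≤t (walk-map (λ { (_ , h<j , h , refl , e) → h , h<j , e }) p)

    timed : ∀ {u v} → proj₁ G u v ≡ true → ∃[ i ] Edge i u v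
    timed e = let j , e′ = Equivalence.to (union _ _) e in toℕ j , j , refl , e′
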